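{- For each integer $j\geq 3$, there are infinitely many pairs $(\lambda,\mu)$ of distinct partitions $\lambda\neq\mu$, both of length $2j$, such that $|\lambda| = |\mu|$ and $\mathrm{pre}_j(\lambda) = \mathrm{pre}_j(\mu)$.
   Context: A partition $\lambda=(\lambda_1,\ldots,\lambda_\ell)$ is a weakly decreasing finite sequence of positive integers; its length is $\ell$ and its size is $|\lambda|=\lambda_1+\cdots+\lambda_\ell$. A partition is identified with its multiset of parts. For $1\le j\le \ell$, $\mathrm{pre}_j(\lambda)$ is the partition whose multiset of parts is $\{\!\{\lambda_{i_1}\cdots\lambda_{i_j} : 1\le i_1<i_2<\cdots<i_j\le \ell\}\!\}$ (one part for each $j$-element subset of indices). -}

module Defs where

open import Data.List.Base using (List; []; _∷_; _++_; map; length)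
open import Data.List.Relation.Unary.All as All using (All; []; _∷_)
import Data.List.Relation.Unary.All.Properties as All
open import Data.List.Relation.Unary.Linked using (Linked)
open import Data.List.Relation.Binary.Permutation.Propositional using (↭-sym)
open import Data.List.Relation.Binary.Permutation.Propositional.Properties
  using (All-resp-↭)
import Data.List.Sort as Sort
open import Data.Nat.Base using (ℕ; zero; suc; _≥_; NonZero)
open import Data.Nat.ListAction using (sum; product)
open import Data.Nat.ListAction.Properties using (product≢0)
open import Data.Nat.Properties using (≤-decTotalOrder)
open import Data.Product.Base using (Σ-syntax; _×_)
open import Function.Definitions using (Injective)
open import Level using (Level; _⊔_)
open import Relation.Binary.Properties.DecTotalOrder ≤-decTotalOrder
  using (≥-decTotalOrder)
open import Relation.Binary.PropositionalEquality.Core using (_≡_)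
open import Relation.Unary using (Pred)

private
  variable
    a p : Level
    A : Set a

module Descending = Sort ≥-decTotalOrder

-- The conditions are irrelevant fields, so `ρ ≡ μ` holds exactly when the two
-- partitions have the same parts.
record Partition : Set where
  constructor mkPartition
  field
    parts       : List ℕ
    .decreasing : Linked _≥_ parts
    .positive   : All NonZero parts

open Partition public using (parts)

len : Partition → ℕ
len π = length (parts π)

∣_∣ : Partition → ℕ
∣ π ∣ = sum (parts π)

fromMultiset : (xs : List ℕ) → .(All NonZero xs) → Partition
fromMultiset xs xs>0 = mkPartition
  (Descending.sort xs)
  (Descending.sort-↗ xs)
  (All-resp-↭ (↭-sym (Descending.sort-↭ xs)) xs>0)

-- All ways of selecting j entries of a list, in order.  Entries are selected by
-- position: equal entries at different positions give separate selections.
choose : ℕ → List A → List (List A)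
choose zero    xs       = [] ∷ []
choose (suc j) []       = []
choose (suc j) (x ∷ xs) = map (x ∷_) (choose j xs) ++ choose (suc j) xs

choose-All : {P : Pred A p} (j : ℕ) {xs : List A} →
             All P xs → All (All P) (choose j xs)
choose-All zero    pxs        = [] ∷ []
choose-All (suc j) []         = []
choose-All (suc j) (px ∷ pxs) =
  All.++⁺ (All.map⁺ (All.map (px ∷_) (choose-All j pxs))) (choose-All (suc j) pxs)

-- Total in j: the notion is intended for 1 ≤ j ≤ len π.
pre : ℕ → Partition → Partition
pre j (mkPartition xs _ xs>0) = fromMultiset
  (map product (choose j xs))
  (All.map⁺ (All.map product≢0 (choose-All j xs>0)))

-- "There are infinitely many x with P x."
InfinitelyMany : {A : Set a} → Pred A p → Set (a ⊔ p)
InfinitelyMany {A = A} P =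
  Σ[ f ∈ (ℕ → A) ] Injective _≡_ _≡_ f × (∀ n → P (f n))

{-# OPTIONS --safe #-}
-- Let λ have length 2j and suppose that the product of its parts is cʲ and that
-- each part divides c.  Then μ = {c / x : x ∈ λ} satisfies preⱼ(μ) = preⱼ(λ):
-- the product of c / x over a j-subset of the indices is the product of x over
-- the complementary j-subset.  For j = 3 and c = 160, the partition
-- (32,32,10,10,10,4) gives (40,16,16,16,5,5), also of size 98.  Adding m parts 1
-- and m parts c to both sides reaches j = 3 + m, and multiplying all parts by a
-- common factor gives infinitely many pairs.
module Submission where

open import Data.List.Base using (List; []; _∷_; [_]; _++_; map; length)
open import Data.List.Membership.Propositional using (_∈_)
open import Data.List.Properties
  using (map-++; map-∘; map-cong; map-injective; length-map; ++-assoc; ++-identityʳ)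
open import Data.List.Relation.Binary.Permutation.Propositional
  using (_↭_; refl; prep; swap; trans; ↭-sym; ↭-reflexive; ↭⇒↭ₛ; module PermutationReasoning)
open import Data.List.Relation.Binary.Permutation.Propositional.Properties
  using (All-resp-↭; ↭-length; ↭-map-inv; map⁺; ++⁺; ++-comm; shifts)
open import Data.List.Relation.Binary.Pointwise as Pointwise
  using (Pointwise; []; _∷_; Pointwise-≡⇒≡)
open import Data.List.Relation.Unary.All as All using (All; []; _∷_)
import Data.List.Relation.Unary.All.Properties as All
open import Data.List.Relation.Unary.Any using (here; there)
open import Data.List.Relation.Unary.Sorted.TotalOrder.Properties using (↗↭↗⇒≋)
open import Data.Nat.Base
  using (ℕ; zero; suc; _+_; _*_; _^_; _≤_; _<_; s≤s; s<s⁻¹; NonZero)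
open import Data.Nat.ListAction using (sum; product)
open import Data.Nat.ListAction.Properties using (sum-↭)
open import Data.Nat.Properties
open import Algebra.Properties.CommutativeSemigroup *-commutativeSemigroup using (xy∙z≈xz∙y)
open import Data.Product.Base using (_×_; _,_; proj₁)
open import Function.Base using (_∘_)
open import Relation.Binary.Bundles using (DecTotalOrder)
open import Relation.Binary.Properties.DecTotalOrder ≤-decTotalOrder
  using (≥-decTotalOrder)
open import Relation.Binary.PropositionalEquality as ≡
  using (_≡_; _≢_; cong; cong₂; module ≡-Reasoning)
open import Relation.Nullary.Negation using (¬_)
open import Defs using
  (Partition; parts; len; ∣_∣; pre; InfinitelyMany; choose; fromMultiset; module Descending)

private
  variable
    xs ys : List ℕ

-- Products over selections: recursion, permutation invariance, complements.

products : ℕ → List ℕ → List ℕ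
products j xs = map product (choose j xs)

products-∷ : ∀ j x xs →
  products (suc j) (x ∷ xs) ≡ map (x *_) (products j xs) ++ products (suc j) xs
products-∷ j x xs = begin
  map product (map (x ∷_) (choose j xs) ++ choose (suc j) xs)
    ≡⟨ map-++ product (map (x ∷_) (choose j xs)) _ ⟩
  map product (map (x ∷_) (choose j xs)) ++ products (suc j) xs
    ≡⟨ cong (_++ products (suc j) xs) (map-∘ (choose j xs)) ⟨
  map (λ zs → x * product zs) (choose j xs) ++ products (suc j) xs
    ≡⟨ cong (_++ products (suc j) xs) (map-∘ (choose j xs)) ⟩
  map (x *_) (products j xs) ++ products (suc j) xs ∎
  where open ≡-Reasoning

products-empty : ∀ j xs → length xs < j → products j xs ≡ []
products-empty (suc j) []       _       = ≡.refl
products-empty (suc j) (x ∷ xs) |xs|<j = begin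
  products (suc j) (x ∷ xs)
    ≡⟨ products-∷ j x xs ⟩
  map (x *_) (products j xs) ++ products (suc j) xs
    ≡⟨ cong₂ (λ as bs → map (x *_) as ++ bs)
         (products-empty j xs (s<s⁻¹ |xs|<j))
         (products-empty (suc j) xs (<-trans (n<1+n _) |xs|<j)) ⟩
  [] ∎
  where open ≡-Reasoning

map-*-* : ∀ a b zs → map (a * b *_) zs ≡ map (a *_) (map (b *_) zs)
map-*-* a b zs = ≡.trans (map-cong (*-assoc a b) zs) (map-∘ zs)

map-*-map-* : ∀ a b c d → a * b ≡ c * d → (zs : List ℕ) →
  map (a *_) (map (b *_) zs) ≡ map (c *_) (map (d *_) zs)
map-*-map-* a b c d ab≡cd zs = begin
  map (a *_) (map (b *_) zs)  ≡⟨ map-*-* a b zs ⟨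
  map (a * b *_) zs           ≡⟨ cong (λ e → map (e *_) zs) ab≡cd ⟩
  map (c * d *_) zs           ≡⟨ map-*-* c d zs ⟩
  map (c *_) (map (d *_) zs)  ∎
  where open ≡-Reasoning

-- The permutation lifts along `c *_` to `xs ↭ zs`, where `zs` and `ys` have the same image.
-- Multiplication by `c` is injective, so `zs` is `ys`.
map-*-cancel-↭ : ∀ c .{{_ : NonZero c}} → map (c *_) xs ↭ map (c *_) ys → xs ↭ ys
map-*-cancel-↭ {xs} {ys} c p with ↭-map-inv (c *_) p
... | zs , eq , q = trans q (↭-reflexive (≡.sym (map-injective (*-cancelˡ-≡ _ _ c) eq)))

-- `fromMultiset` sorts its parts before `pre` selects from them. Invariance under reordering lets
-- the calculations use lists in whatever order is convenient.
products-↭ : ∀ j → xs ↭ ys → products j xs ↭ products j ys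
products-↭ zero    _ = refl
products-↭ (suc j) refl = refl
products-↭ (suc j) (trans p q) = trans (products-↭ (suc j) p) (products-↭ (suc j) q)
products-↭ (suc j) (prep {xs} {ys} x p) = begin
  products (suc j) (x ∷ xs)                          ≡⟨ products-∷ j x xs ⟩
  map (x *_) (products j xs) ++ products (suc j) xs
    ↭⟨ ++⁺ (map⁺ (x *_) (products-↭ j p)) (products-↭ (suc j) p) ⟩
  map (x *_) (products j ys) ++ products (suc j) ys  ≡⟨ products-∷ j x ys ⟨
  products (suc j) (x ∷ ys)                          ∎
  where open PermutationReasoning
-- A one-element selection never contains both `x` and `y`, so the two leading entries are simply
-- exchanged.
products-↭ (suc zero) (swap x y p) = swap _ _ (products-↭ 1 p)
products-↭ (suc (suc j)) (swap {xs} {ys} x y p) = begin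
  products (2 + j) (x ∷ y ∷ xs)
    ≡⟨ expand x y xs ⟩
  map (x *_) (map (y *_) (products j xs)) ++ map (x *_) (products (suc j) xs) ++
    map (y *_) (products (suc j) xs) ++ products (2 + j) xs
    ↭⟨ ++⁺ (↭-reflexive (map-*-map-* x y y x (*-comm x y) (products j xs)))
           (shifts (map (x *_) (products (suc j) xs)) (map (y *_) (products (suc j) xs))) ⟩
  map (y *_) (map (x *_) (products j xs)) ++ map (y *_) (products (suc j) xs) ++
    map (x *_) (products (suc j) xs) ++ products (2 + j) xs
    ↭⟨ ++⁺ (map⁺ (y *_) (map⁺ (x *_) (products-↭ j p)))
       (++⁺ (map⁺ (y *_) (products-↭ (suc j) p))
       (++⁺ (map⁺ (x *_) (products-↭ (suc j) p)) (products-↭ (2 + j) p))) ⟩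
  map (y *_) (map (x *_) (products j ys)) ++ map (y *_) (products (suc j) ys) ++
    map (x *_) (products (suc j) ys) ++ products (2 + j) ys
    ≡⟨ expand y x ys ⟨
  products (2 + j) (y ∷ x ∷ ys) ∎
  where
  open PermutationReasoning
  -- Four blocks: selections with both `u` and `v`, with `u` only, with `v` only, with neither.
  -- Swapping `u` and `v` exchanges the two middle blocks and fixes the outer ones, the first by
  -- commutativity.
  expand : ∀ u v zs → products (2 + j) (u ∷ v ∷ zs) ≡
    map (u *_) (map (v *_) (products j zs)) ++ map (u *_) (products (suc j) zs) ++
    map (v *_) (products (suc j) zs) ++ products (2 + j) zs
  expand u v zs
    rewrite products-∷ (suc j) u (v ∷ zs) | products-∷ j v zs | products-∷ (suc j) v zs
          | map-++ (u *_) (map (v *_) (products j zs)) (products (suc j) zs)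
    = ++-assoc (map (u *_) (map (v *_) (products j zs))) _ _

-- Multiplying by product xs turns the product of an l-subset of ys into cˡ times
-- the product of the complementary k-subset of xs.
products-complement : ∀ {c} k l → Pointwise (λ x y → x * y ≡ c) xs ys →
  k + l ≡ length xs →
  map (product xs *_) (products l ys) ↭ map (c ^ l *_) (products k xs)
products-complement zero zero [] _ = refl
products-complement {x ∷ xs} {y ∷ ys} {c} zero (suc l) (xy≡c ∷ r) eq = begin
  map (x * product xs *_) (products (suc l) (y ∷ ys))
    ≡⟨ cong (map _) (products-∷ l y ys) ⟩
  map (x * product xs *_) (map (y *_) (products l ys) ++ products (suc l) ys)
    -- Here `ys` has exactly `l` entries, so every selection of `suc l` entries must use `y`.
    ≡⟨ cong (λ zs → map _ (map (y *_) (products l ys) ++ zs)) (products-empty (suc l) ys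
         (≤-reflexive (cong suc (≡.trans (≡.sym (Pointwise.Pointwise-length r)) (≡.sym (suc-injective eq)))))) ⟩
  map (x * product xs *_) (map (y *_) (products l ys) ++ [])
    ≡⟨ cong (map _) (++-identityʳ _) ⟩
  map (x * product xs *_) (map (y *_) (products l ys))
    ≡⟨ map-*-map-* (x * product xs) y c (product xs)
         (≡.trans (xy∙z≈xz∙y x (product xs) y) (cong (_* product xs) xy≡c)) (products l ys) ⟩
  map (c *_) (map (product xs *_) (products l ys))
    ↭⟨ map⁺ (c *_) (products-complement zero l r (suc-injective eq)) ⟩
  [ c * (c ^ l * 1) ]
    ≡⟨ cong [_] (*-assoc c (c ^ l) 1) ⟨
  [ c * c ^ l * 1 ] ∎
  where
  open PermutationReasoning
products-complement {x ∷ xs} {y ∷ ys} {c} (suc k) zero (_ ∷ r) eq = begin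
  [ x * product xs * 1 ]
    ≡⟨ cong [_] (*-assoc x (product xs) 1) ⟩
  map (x *_) [ product xs * 1 ]
    ↭⟨ map⁺ (x *_) (products-complement k zero r (suc-injective eq)) ⟩
  map (x *_) (map (1 *_) (products k xs))
    ≡⟨ map-*-map-* x 1 1 x (*-comm x 1) (products k xs) ⟩
  map (1 *_) (map (x *_) (products k xs))
    ≡⟨ cong (map _) (++-identityʳ _) ⟨
  map (1 *_) (map (x *_) (products k xs) ++ [])
    ≡⟨ cong (λ zs → map _ (map (x *_) (products k xs) ++ zs)) (products-empty (suc k) xs
         (≤-reflexive (cong suc (≡.trans (≡.sym (suc-injective eq)) (+-identityʳ k))))) ⟨
  map (1 *_) (map (x *_) (products k xs) ++ products (suc k) xs)
    ≡⟨ cong (map _) (products-∷ k x xs) ⟨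
  map (1 *_) (products (suc k) (x ∷ xs)) ∎
  where open PermutationReasoning
products-complement {x ∷ xs} {y ∷ ys} {c} (suc k) (suc l) (xy≡c ∷ r) eq = begin
  map (x * X *_) (products (suc l) (y ∷ ys))
    ≡⟨ cong (map _) (products-∷ l y ys) ⟩
  map (x * X *_) (map (y *_) (products l ys) ++ products (suc l) ys)
    ≡⟨ map-++ _ (map (y *_) (products l ys)) _ ⟩
  map (x * X *_) (map (y *_) (products l ys)) ++ map (x * X *_) (products (suc l) ys)
    ≡⟨ cong₂ _++_
         (map-*-map-* (x * X) y c X
           (≡.trans (xy∙z≈xz∙y x X y) (cong (_* X) xy≡c)) (products l ys))
         (map-*-* x X (products (suc l) ys)) ⟩
  map (c *_) (map (X *_) (products l ys)) ++ map (x *_) (map (X *_) (products (suc l) ys))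
    -- A selection that uses `y` has a complement avoiding `x`, and `x * y` supplies one factor `c`.
    -- A selection that avoids `y` has a complement containing `x`. The two blocks thus come out in
    -- the opposite order to the recursion for `xs`.
    ↭⟨ ++⁺ (map⁺ (c *_) (products-complement (suc k) l r
              (≡.trans (≡.sym (+-suc k l)) (suc-injective eq))))
           (map⁺ (x *_) (products-complement k (suc l) r (suc-injective eq))) ⟩
  map (c *_) (map (c ^ l *_) (products (suc k) xs)) ++
    map (x *_) (map (c ^ suc l *_) (products k xs))
    ↭⟨ ++-comm (map (c *_) (map (c ^ l *_) (products (suc k) xs))) _ ⟩
  map (x *_) (map (c ^ suc l *_) (products k xs)) ++
    map (c *_) (map (c ^ l *_) (products (suc k) xs))
    ≡⟨ cong₂ _++_
         (map-*-map-* x (c ^ suc l) (c ^ suc l) x (*-comm x (c ^ suc l)) (products k xs))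
         (≡.sym (map-*-* c (c ^ l) (products (suc k) xs))) ⟩
  map (c ^ suc l *_) (map (x *_) (products k xs)) ++ map (c ^ suc l *_) (products (suc k) xs)
    ≡⟨ map-++ _ (map (x *_) (products k xs)) _ ⟨
  map (c ^ suc l *_) (map (x *_) (products k xs) ++ products (suc k) xs)
    ≡⟨ cong (map _) (products-∷ k x xs) ⟨
  map (c ^ suc l *_) (products (suc k) (x ∷ xs)) ∎
  where
  open PermutationReasoning
  X = product xs

-- With `k = l = j` in `products-complement`, both sides carry the factor `c ^ j`, which cancels.
products-reciprocal : ∀ {c} .{{_ : NonZero c}} j → Pointwise (λ x y → x * y ≡ c) xs ys →
  length xs ≡ 2 * j → product xs ≡ c ^ j → products j xs ↭ products j ys
products-reciprocal {xs} {ys} {c} j r |xs|≡2j Πxs≡c^j =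
  ↭-sym (map-*-cancel-↭ (c ^ j) {{m^n≢0 c j}}
    (≡.subst (λ a → map (a *_) (products j ys) ↭ map (c ^ j *_) (products j xs)) Πxs≡c^j
      (products-complement j j r
        (≡.trans (cong (j +_) (≡.sym (+-identityʳ j))) (≡.sym |xs|≡2j)))))

-- Partitions built by sorting a multiset.

-- A multiset has only one descending arrangement.
sort-cong-↭ : xs ↭ ys → Descending.sort xs ≡ Descending.sort ys
sort-cong-↭ {xs} {ys} p = Pointwise-≡⇒≡
  (↗↭↗⇒≋ (DecTotalOrder.totalOrder ≥-decTotalOrder)
    (Descending.sort-↗ xs) (Descending.sort-↗ ys)
    (↭⇒↭ₛ (trans (Descending.sort-↭ xs) (trans p (↭-sym (Descending.sort-↭ ys))))))

parts-injective : ∀ {π ρ} → parts π ≡ parts ρ → π ≡ ρ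
parts-injective ≡.refl = ≡.refl

fromMultiset-injective : .(xs>0 : All NonZero xs) .(ys>0 : All NonZero ys) →
  fromMultiset xs xs>0 ≡ fromMultiset ys ys>0 → xs ↭ ys
fromMultiset-injective {xs} {ys} _ _ eq =
  trans (↭-sym (Descending.sort-↭ xs))
    (trans (↭-reflexive (cong parts eq)) (Descending.sort-↭ ys))

pre-cong : ∀ j π ρ → products j (parts π) ↭ products j (parts ρ) → pre j π ≡ pre j ρ
pre-cong j π ρ p = parts-injective (sort-cong-↭ p)

pre-fromMultiset-cong : ∀ j .(xs>0 : All NonZero xs) .(ys>0 : All NonZero ys) →
  products j xs ↭ products j ys →
  pre j (fromMultiset xs xs>0) ≡ pre j (fromMultiset ys ys>0)
pre-fromMultiset-cong {xs} {ys} j xs>0 ys>0 p =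
  pre-cong j (fromMultiset xs xs>0) (fromMultiset ys ys>0)
    (trans (products-↭ j (Descending.sort-↭ xs))
      (trans p (↭-sym (products-↭ j (Descending.sort-↭ ys)))))

length-fromMultiset : ∀ xs .(xs>0 : All NonZero xs) → len (fromMultiset xs xs>0) ≡ length xs
length-fromMultiset xs _ = ↭-length (Descending.sort-↭ xs)

sum-fromMultiset : ∀ xs .(xs>0 : All NonZero xs) → ∣ fromMultiset xs xs>0 ∣ ≡ sum xs
sum-fromMultiset xs _ = sum-↭ (Descending.sort-↭ xs)

-- Scaling and padding of lists.

sum-map-* : ∀ t xs → sum (map (t *_) xs) ≡ t * sum xs
sum-map-* t []       = ≡.sym (*-zeroʳ t)
sum-map-* t (x ∷ xs) = ≡.trans (cong (t * x +_) (sum-map-* t xs)) (≡.sym (*-distribˡ-+ t x (sum xs)))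

product-map-* : ∀ t xs → product (map (t *_) xs) ≡ t ^ length xs * product xs
product-map-* t []       = ≡.refl
product-map-* t (x ∷ xs) = ≡.trans (cong (t * x *_) (product-map-* t xs))
  ([m*n]*[o*p]≡[m*o]*[n*p] t x (t ^ length xs) (product xs))

^-distribʳ-* : ∀ o m n → (m * n) ^ o ≡ m ^ o * n ^ o
^-distribʳ-* zero    m n = ≡.refl
^-distribʳ-* (suc o) m n = ≡.trans (cong (m * n *_) (^-distribʳ-* o m n))
  ([m*n]*[o*p]≡[m*o]*[n*p] m n (m ^ o) (n ^ o))

map-*-NonZero : ∀ t .{{_ : NonZero t}} → All NonZero xs → All NonZero (map (t *_) xs)
map-*-NonZero t {{t≢0}} = All.map⁺ ∘ All.map (λ {x} x≢0 → m*n≢0 t x {{t≢0}} {{x≢0}})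

-- The order of `a` and `b` matters: padding one list by `1, c` and the other by `c, 1` adds the
-- same multiset to both, while entries in equal positions multiply to `c`.
pad : ℕ → ℕ → ℕ → List ℕ → List ℕ
pad a b zero    xs = xs
pad a b (suc m) xs = a ∷ b ∷ pad a b m xs

module _ {a b : ℕ} where

  pad-All : ∀ {p} {P : ℕ → Set p} m → P a → P b → All P xs → All P (pad a b m xs)
  pad-All zero    pa pb pxs = pxs
  pad-All (suc m) pa pb pxs = pa ∷ pb ∷ pad-All m pa pb pxs

  ∈-pad : ∀ {x} m → x ∈ xs → x ∈ pad a b m xs
  ∈-pad zero    x∈xs = x∈xs
  ∈-pad (suc m) x∈xs = there (there (∈-pad m x∈xs))

  length-pad : ∀ m xs → length (pad a b m xs) ≡ m * 2 + length xs
  length-pad zero    xs = ≡.refl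
  length-pad (suc m) xs = cong (2 +_) (length-pad m xs)

  sum-pad : ∀ m xs → sum (pad a b m xs) ≡ m * (a + b) + sum xs
  sum-pad zero    xs = ≡.refl
  sum-pad (suc m) xs = begin
    a + (b + sum (pad a b m xs))        ≡⟨ +-assoc a b _ ⟨
    a + b + sum (pad a b m xs)          ≡⟨ cong (a + b +_) (sum-pad m xs) ⟩
    a + b + (m * (a + b) + sum xs)      ≡⟨ +-assoc (a + b) _ _ ⟨
    suc m * (a + b) + sum xs            ∎
    where open ≡-Reasoning

  product-pad : ∀ m xs → product (pad a b m xs) ≡ (a * b) ^ m * product xs
  product-pad zero    xs = ≡.sym (*-identityˡ (product xs))
  product-pad (suc m) xs = begin
    a * (b * product (pad a b m xs))        ≡⟨ *-assoc a b _ ⟨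
    a * b * product (pad a b m xs)          ≡⟨ cong (a * b *_) (product-pad m xs) ⟩
    a * b * ((a * b) ^ m * product xs)      ≡⟨ *-assoc (a * b) _ _ ⟨
    (a * b) ^ suc m * product xs            ∎
    where open ≡-Reasoning

pad-Pointwise : ∀ {R : ℕ → ℕ → Set} {a b a′ b′} m → R a a′ → R b b′ →
  Pointwise R xs ys → Pointwise R (pad a b m xs) (pad a′ b′ m ys)
pad-Pointwise zero    raa′ rbb′ r = r
pad-Pointwise (suc m) raa′ rbb′ r = raa′ ∷ rbb′ ∷ pad-Pointwise m raa′ rbb′ r

scale-reciprocal : ∀ {c} t → Pointwise (λ x y → x * y ≡ c) xs ys →
  Pointwise (λ x y → x * y ≡ t ^ 2 * c) (map (t *_) xs) (map (t *_) ys)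
scale-reciprocal t [] = []
scale-reciprocal {c = c} t (_∷_ {x = x} {y = y} xy≡c r) = (begin
  t * x * (t * y)  ≡⟨ [m*n]*[o*p]≡[m*o]*[n*p] t x t y ⟩
  t * t * (x * y)  ≡⟨ cong₂ _*_ (cong (t *_) (≡.sym (*-identityʳ t))) xy≡c ⟩
  t ^ 2 * c        ∎) ∷ scale-reciprocal t r
  where open ≡-Reasoning

-- The factor `t` occurs `2 * j` times, which matches the new constant `t ^ 2 * c` of
-- `scale-reciprocal` raised to the power `j`.
scale-product : ∀ {c} t j xs → length xs ≡ 2 * j → product xs ≡ c ^ j →
  product (map (t *_) xs) ≡ (t ^ 2 * c) ^ j
scale-product {c} t j xs |xs|≡2j Πxs≡c^j = begin
  product (map (t *_) xs)    ≡⟨ product-map-* t xs ⟩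
  t ^ length xs * product xs ≡⟨ cong₂ _*_ (cong (t ^_) |xs|≡2j) Πxs≡c^j ⟩
  t ^ (2 * j) * c ^ j        ≡⟨ cong (_* c ^ j) (^-*-assoc t 2 j) ⟨
  (t ^ 2) ^ j * c ^ j        ≡⟨ ^-distribʳ-* j (t ^ 2) c ⟨
  (t ^ 2 * c) ^ j            ∎
  where open ≡-Reasoning

-- From one pair to infinitely many.

-- Scaling both lists by the same positive factor preserves all the relations between them, and the
-- nonzero sum of `xs` makes the scaled sizes pairwise different.
reciprocal-pairs : ∀ {c} .{{_ : NonZero c}} j → All NonZero xs → All NonZero ys →
  Pointwise (λ x y → x * y ≡ c) xs ys → length xs ≡ 2 * j → product xs ≡ c ^ j →
  sum xs ≡ sum ys → .{{NonZero (sum xs)}} → ¬ (xs ↭ ys) →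
  InfinitelyMany {A = Partition × Partition} λ (ρ , μ) →
    ρ ≢ μ × len ρ ≡ 2 * j × len μ ≡ 2 * j × ∣ ρ ∣ ≡ ∣ μ ∣ × pre j ρ ≡ pre j μ
reciprocal-pairs {xs} {ys} {c} j xs>0 ys>0 r |xs|≡2j Πxs≡c^j Σxs≡Σys xs≄ys =
  -- The factor is `suc n`, so that `n = 0` also leaves all parts positive.
  (λ n → scaled n xs>0 , scaled n ys>0) , injective , λ n →
    xs≄ys ∘ map-*-cancel-↭ (suc n) ∘ fromMultiset-injective (map-*-NonZero (suc n) xs>0) (map-*-NonZero (suc n) ys>0) ,
    ≡.trans (len-scaled n xs>0) |xs|≡2j ,
    ≡.trans (len-scaled n ys>0) (≡.trans (≡.sym (Pointwise.Pointwise-length r)) |xs|≡2j) ,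
    ≡.trans (size-scaled n xs>0) (≡.trans (cong (suc n *_) Σxs≡Σys) (≡.sym (size-scaled n ys>0))) ,
    pre-fromMultiset-cong j (map-*-NonZero (suc n) xs>0) (map-*-NonZero (suc n) ys>0)
      (products-reciprocal {{m*n≢0 (suc n ^ 2) c {{m^n≢0 (suc n) 2}}}} j
        (scale-reciprocal (suc n) r)
        (≡.trans (length-map _ xs) |xs|≡2j)
        (scale-product (suc n) j xs |xs|≡2j Πxs≡c^j))
  where
  scaled : ∀ n {zs} → All NonZero zs → Partition
  scaled n {zs} zs>0 = fromMultiset (map (suc n *_) zs) (map-*-NonZero (suc n) zs>0)

  len-scaled : ∀ n {zs} (zs>0 : All NonZero zs) → len (scaled n zs>0) ≡ length zs
  len-scaled n {zs} zs>0 =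
    ≡.trans (length-fromMultiset _ (map-*-NonZero (suc n) zs>0)) (length-map _ zs)

  size-scaled : ∀ n {zs} (zs>0 : All NonZero zs) → ∣ scaled n zs>0 ∣ ≡ suc n * sum zs
  size-scaled n {zs} zs>0 =
    ≡.trans (sum-fromMultiset _ (map-*-NonZero (suc n) zs>0)) (sum-map-* (suc n) zs)

  injective : ∀ {m n} →
    (scaled m xs>0 , scaled m ys>0) ≡ (scaled n xs>0 , scaled n ys>0) → m ≡ n
  -- The first partition has size `suc n * sum xs`, which determines `n`.
  injective {m} {n} eq = suc-injective (*-cancelʳ-≡ (suc m) (suc n) (sum xs)
    (≡.trans (≡.sym (size-scaled m xs>0))
      (≡.trans (cong (∣_∣ ∘ proj₁) eq) (size-scaled n xs>0))))

theorem1p2 : (j : ℕ) → 3 ≤ j →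
    InfinitelyMany {A = Partition × Partition} λ (ρ , μ) →
    ρ ≢ μ × len ρ ≡ 2 * j × len μ ≡ 2 * j × ∣ ρ ∣ ≡ ∣ μ ∣ × pre j ρ ≡ pre j μ
theorem1p2 (suc (suc (suc m))) (s≤s (s≤s (s≤s _))) =
  reciprocal-pairs {xs = pad 1 160 m λ₃} {ys = pad 160 1 m μ₃} (3 + m)
    (pad-All m _ _ (_ ∷ _ ∷ _ ∷ _ ∷ _ ∷ _ ∷ []))
    (pad-All m _ _ (_ ∷ _ ∷ _ ∷ _ ∷ _ ∷ _ ∷ []))
    (pad-Pointwise m ≡.refl ≡.refl
      (≡.refl ∷ ≡.refl ∷ ≡.refl ∷ ≡.refl ∷ ≡.refl ∷ ≡.refl ∷ []))
    (≡.trans (length-pad m λ₃) (≡.trans (+-comm (m * 2) 6) (*-comm (3 + m) 2)))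
    -- The product of `λ₃` computes to `160 ^ 3`, and each padding pair contributes `1 * 160`.
    (≡.trans (product-pad m λ₃)
      (≡.trans (≡.sym (^-distribˡ-+-* 160 m 3)) (cong (160 ^_) (+-comm m 3))))
    (≡.trans (sum-pad m λ₃) (≡.sym (sum-pad m μ₃)))
    -- With the 98 moved to the front, the sum is visibly a successor.
    {{≡.subst NonZero (≡.sym (≡.trans (sum-pad m λ₃) (+-comm (m * 161) 98))) _}}
    -- The part 4 separates the two sides: it occurs in `λ₃`, but neither in `μ₃` nor among the
    -- padding entries 160 and 1.
    λ p → All.lookup
      (All-resp-↭ (↭-sym p) (pad-All {P = _≢ 4} m (λ ()) (λ ())
        ((λ ()) ∷ (λ ()) ∷ (λ ()) ∷ (λ ()) ∷ (λ ()) ∷ (λ ()) ∷ [])))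
      (∈-pad m (here ≡.refl)) ≡.refl
  where
  -- Both lists are arranged so that entries in the same position multiply to 160.
  λ₃ μ₃ : List ℕ
  λ₃ = 4  ∷ 10 ∷ 10 ∷ 10 ∷ 32 ∷ 32 ∷ []
  μ₃ = 40 ∷ 16 ∷ 16 ∷ 16 ∷ 5  ∷ 5  ∷ []
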